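{- Let $b>3$ be a strongly symmetric base. Then $b+1$ is prime.
   Context: Let $b>2$ be an integer base and write $(d_k,d_{k-1},\ldots,d_0)_b=\sum_{j=0}^k d_j b^j$ with $0\le d_j<b$. A natural number $p=(d_k,\ldots,d_0)_b$ with $d_k\neq 0$ and $d_0\neq 0$ that is not a base-$b$ palindrome is an $(n,b)$-palintiple if $(d_k,\ldots,d_0)_b=n\,(d_0,d_1,\ldots,d_k)_b$ for an integer $n$ with $1<n<b$; a base-$b$ palintiple is an $(n,b)$-palintiple for some such $n$. Its carries $c_0,\ldots,c_{k+1}$ are the carries arising in the base-$b$ multiplication of $(d_0,\ldots,d_k)_b$ by $n$: $c_0=0$ and $n d_{k-j}+c_j=d_j+b\,c_{j+1}$ for $0\le j\le k$ (so $c_{k+1}=0$). The palintiple is symmetric if $c_j=c_{k-j}$ for all $0\le j\le k$. A base $b$ is strongly symmetric if every base-$b$ palintiple (for every $n$ with $1<n<b$) is symmetric. -}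

module Defs where

open import Data.Digit using (Digit; fromDigits)
open import Data.Fin using (Fin; zero; suc; toℕ; fromℕ; inject₁; opposite)
open import Data.List using (tabulate)
open import Data.Nat using (ℕ; suc; _+_; _*_; _<_)
open import Function using (_∘_)
open import Relation.Binary.PropositionalEquality using (_≡_; _≢_)
open import Relation.Nullary using (¬_)

-- The base-b digits d₀, …, d_k, least significant first: d j is the
-- coefficient of b ^ j.  The map opposite sends j to k - j.
Digits : ℕ → ℕ → Set
Digits b k = Fin (suc k) → Digit b

-- The number (d_k , … , d₀)_b; fromDigits also reads the least
-- significant digit first.
value : ∀ {b k} → Digits b k → ℕ
value d = fromDigits (tabulate d)

reversed : ∀ {b k} → Digits b k → Digits b k
reversed d = d ∘ opposite

Palindrome : ∀ {b k} → Digits b k → Set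
Palindrome d = ∀ j → d j ≡ reversed d j

-- A number with nonzero leading digit is identified with its (unique)
-- digit sequence.
record IsPalintiple (n b : ℕ) {k : ℕ} (d : Digits b k) : Set where
  field
    1<n           : 1 < n
    n<b           : n < b
    leading≢0     : toℕ (d (fromℕ k)) ≢ 0
    units≢0       : toℕ (d zero) ≢ 0
    notPalindrome : ¬ Palindrome d
    isMultiple    : value d ≡ n * value (reversed d)

-- c₀, …, c_{k+1} are the carries when (d₀ , … , d_k)_b is multiplied
-- by n, giving (d_k , … , d₀)_b.
record IsCarries (n : ℕ) {b k : ℕ} (d : Digits b k)
                 (c : Fin (suc (suc k)) → ℕ) : Set where
  field
    initial : c zero ≡ 0
    step    : ∀ (j : Fin (suc k)) →
              n * toℕ (d (opposite j)) + c (inject₁ j) ≡ toℕ (d j) + b * c (suc j)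

-- For a palintiple the carries exist and are unique, so quantifying over
-- all c satisfying IsCarries refers to exactly that sequence.
IsSymmetric : (n : ℕ) {b k : ℕ} → Digits b k → Set
IsSymmetric n {b} {k} d =
  ∀ (c : Fin (suc (suc k)) → ℕ) → IsCarries n d c →
  ∀ (j : Fin (suc k)) → c (inject₁ j) ≡ c (inject₁ (opposite j))

StronglySymmetric : ℕ → Set
StronglySymmetric b =
  ∀ (n k : ℕ) (d : Digits b k) → IsPalintiple n b d → IsSymmetric n d

{-# OPTIONS --safe #-}
-- Suppose b + 1 = u v with u ≥ 3 and v ≥ 2.  Then (b − v , v − 1)_b is a
-- (u − 1 , b)-palintiple with the single inner carry u − 2 ≠ 0.  A two-digit
-- palintiple is symmetric only if its inner carry equals c₀ = 0, so this one
-- is not symmetric.  Since b + 1 > 4, one factor of any nontrivial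
-- factorisation of b + 1 is at least 3 and can serve as u.
module Submission where

open import Defs
open import Data.Digit using (Digit)
open import Data.Fin using (Fin; zero; suc; toℕ; fromℕ<)
open import Data.Fin.Properties using (toℕ-fromℕ<)
open import Data.Nat using (ℕ; suc; _+_; _*_; _<_; z≤n; s≤s; z<s; n>1⇒nonTrivial; nonTrivial⇒n>1)
open import Data.Nat.Divisibility using (divides; quotient>1; hasNonTrivialDivisor)
open import Data.Nat.Primality using (Prime; prime)
open import Data.Nat.Properties
open import Data.Nat.Tactic.RingSolver using (solve-∀)
open import Relation.Binary.PropositionalEquality
open import Relation.Nullary using (¬_; contradiction)

twoDigits : ∀ {b} → Digit b → Digit b → Digits b 1
twoDigits d₀ d₁ zero       = d₀
twoDigits d₀ d₁ (suc zero) = d₁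

twoDigitCarries : ℕ → Fin 3 → ℕ
twoDigitCarries c zero             = 0
twoDigitCarries c (suc zero)       = c
twoDigitCarries c (suc (suc zero)) = 0

-- `low` and `high` are the carry equations at positions 0 and 1, with the outer carries, both 0,
-- already dropped.
module _ {n b c : ℕ} {d₀ d₁ : Digit b}
         (low  : n * toℕ d₁ ≡ toℕ d₀ + b * c)
         (high : n * toℕ d₀ + c ≡ toℕ d₁)
         where

  twoDigits-isCarries : IsCarries n (twoDigits d₀ d₁) (twoDigitCarries c)
  twoDigits-isCarries = record
    { initial = refl
    ; step    = λ where
        zero       → trans (+-identityʳ _) low
        (suc zero) → trans high (sym (trans (cong (toℕ d₁ +_) (*-zeroʳ b)) (+-identityʳ _)))
    }

  twoDigits-isMultiple : value (twoDigits d₀ d₁) ≡ n * value (reversed (twoDigits d₀ d₁))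
  -- `low` plus `b` times `high`: the carry enters as `b * c` on both sides and cancels.
  twoDigits-isMultiple = begin
    x + (toℕ d₁ + 0) * b        ≡⟨ cong (λ y → x + (y + 0) * b) high ⟨
    x + (n * x + c + 0) * b     ≡⟨ rearrange n b c x ⟩
    x + b * c + n * x * b       ≡⟨ cong (_+ n * x * b) low ⟨
    n * toℕ d₁ + n * x * b      ≡⟨ collect n b x (toℕ d₁) ⟩
    n * (toℕ d₁ + (x + 0) * b)  ∎
    where
    open ≡-Reasoning
    x = toℕ d₀
    rearrange : ∀ n b c x → x + (n * x + c + 0) * b ≡ x + b * c + n * x * b
    rearrange = solve-∀
    collect : ∀ n b x y → n * y + n * x * b ≡ n * (y + (x + 0) * b)
    collect = solve-∀

  twoDigits-isPalintiple : 1 < n → n < b → toℕ d₀ ≢ 0 → toℕ d₀ < toℕ d₁ →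
                           IsPalintiple n b (twoDigits d₀ d₁)
  twoDigits-isPalintiple 1<n n<b d₀≢0 d₀<d₁ = record
    { 1<n           = 1<n
    ; n<b           = n<b
    ; leading≢0     = m<n⇒n≢0 d₀<d₁
    ; units≢0       = d₀≢0
    ; notPalindrome = λ pal → <⇒≢ d₀<d₁ (cong toℕ (pal zero))
    ; isMultiple    = twoDigits-isMultiple
    }

  twoDigits-asymmetric : c ≢ 0 → ¬ IsSymmetric n (twoDigits d₀ d₁)
  -- At index `zero`, symmetry reads `0 ≡ c`.
  twoDigits-asymmetric c≢0 sym-d = c≢0 (sym (sym-d _ twoDigits-isCarries zero))

-- With u = 3 + s and v = 2 + t, the base here is u v − 1 in normal form.
¬stronglySymmetric : ∀ s t → ¬ StronglySymmetric (suc (t + (2 + s) * (2 + t)))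
¬stronglySymmetric s t strong =
  twoDigits-asymmetric low high (λ ())
    (strong n 1 _ (twoDigits-isPalintiple low high (s≤s (s≤s z≤n)) n<b d₀≢0 d₀<d₁))
  where
  n = 2 + s
  b = suc (t + (2 + s) * (2 + t))
  -- `x` is v - 1 and `y` is b - v = (u - 1) v - 1, expanded to avoid truncated subtraction.
  x = suc t
  y = suc t + (1 + s) * (2 + t)

  x<y : x < y
  x<y = m<m+n x (s≤s z≤n)

  y<b : y < b
  -- `(2 + s) * (2 + t)` computes to `(2 + t) + (1 + s) * (2 + t)`, so the gap from `y` to `b` is v.
  y<b = s≤s (+-monoʳ-< t (m<n+m ((1 + s) * (2 + t)) {2 + t} (s≤s z≤n)))

  x<b : x < b
  x<b = <-trans x<y y<b

  n<b : n < b
  n<b = s≤s (≤-trans (m≤m*n n (2 + t)) (m≤n+m _ t))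

  toℕ-x : toℕ (fromℕ< x<b) ≡ x
  toℕ-x = toℕ-fromℕ< x<b

  toℕ-y : toℕ (fromℕ< y<b) ≡ y
  toℕ-y = toℕ-fromℕ< y<b

  d₀≢0 : toℕ (fromℕ< x<b) ≢ 0
  d₀≢0 = subst (_≢ 0) (sym toℕ-x) λ ()

  d₀<d₁ : toℕ (fromℕ< x<b) < toℕ (fromℕ< y<b)
  d₀<d₁ = subst₂ _<_ (sym toℕ-x) (sym toℕ-y) x<y

  low-xy : ∀ s t → (2 + s) * (suc t + (1 + s) * (2 + t)) ≡
                   suc t + suc (t + (2 + s) * (2 + t)) * suc s
  low-xy = solve-∀

  high-xy : ∀ s t → (2 + s) * suc t + suc s ≡ suc t + (1 + s) * (2 + t)
  high-xy = solve-∀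

  low : n * toℕ (fromℕ< y<b) ≡ toℕ (fromℕ< x<b) + b * suc s
  low = subst₂ (λ x′ y′ → n * y′ ≡ x′ + b * suc s) (sym toℕ-x) (sym toℕ-y) (low-xy s t)

  high : n * toℕ (fromℕ< x<b) + suc s ≡ toℕ (fromℕ< y<b)
  high = subst₂ (λ x′ y′ → n * x′ + suc s ≡ y′) (sym toℕ-x) (sym toℕ-y) (high-xy s t)

stronglySymmetric⇒irreducible : ∀ {b} → 3 < b → StronglySymmetric b →
                                ∀ {u v} → 1 < u → 1 < v → suc b ≢ u * v
-- Here `u * v` computes to a successor, so `refl` turns `b` into exactly the base of
-- `¬stronglySymmetric`.
stronglySymmetric⇒irreducible 3<b strong
  {suc (suc (suc s))} {suc (suc t)} (s≤s (s≤s _)) (s≤s (s≤s _)) refl =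
  ¬stronglySymmetric s t strong
-- With u = 2 the factors trade places, so v = 2 and `t` is 0.
stronglySymmetric⇒irreducible 3<b strong
  {2} {suc (suc (suc s))} (s≤s (s≤s _)) (s≤s (s≤s _)) eq
  with refl ← trans eq (*-comm 2 (3 + s)) = ¬stronglySymmetric s 0 strong
-- The factorisation 2 · 2 forces b = 3.
stronglySymmetric⇒irreducible 3<b strong
  {2} {2} (s≤s (s≤s _)) (s≤s (s≤s _)) refl =
  contradiction 3<b (<-irrefl refl)

theorem2 : (b : ℕ) → 3 < b → StronglySymmetric b → Prime (b + 1)
theorem2 b 3<b strong rewrite +-comm b 1 = prime {{n>1⇒nonTrivial (s≤s (<-trans z<s 3<b))}} λ where
  -- Since `d` is a proper divisor, its cofactor also exceeds 1.
  (hasNonTrivialDivisor {divisor = d} d<1+b d∣1+b@(divides _ eq)) →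
    stronglySymmetric⇒irreducible 3<b strong (quotient>1 d∣1+b d<1+b) (nonTrivial⇒n>1 d) eq
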